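{- Let $r\ge 1$ and $k\ge 1$ be integers and let $b=(b_1,\ldots,b_r)$ be a vector of positive integers. Then there exists a $k$-partition $x_1,\ldots,x_k\in\mathbb{Z}_+^r\setminus\{0\}$ of $b$ satisfying $D(x_i)\ge D(b)$ for all $i\in\{1,\ldots,k\}$ if and only if $k\le \gcd(b_1,\ldots,b_r)$.
   Context: $\mathbb{Z}_+^r$ denotes the vectors with $r$ non-negative integer entries. A $k$-partition of $b$ is a collection of vectors $x_1,\ldots,x_k\in\mathbb{Z}_+^r$ with $\sum_{i=1}^k x_i=b$. For a nonzero vector $x\in\mathbb{Z}_+^r$, the diversity (Simpson dominance index) is $D(x)=\|x\|_1^2/\|x\|_2^2$, with $\|\cdot\|_1,\|\cdot\|_2$ the $\ell_1$ and $\ell_2$ norms. -}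

module Defs where

open import Data.Nat using (ℕ; suc; _+_; _^_; _≤_; _<_; NonZero; ≢-nonZero)
open import Data.Nat.GCD using (gcd)
open import Data.Nat.Properties using (m+n≡0⇒m≡0; m+n≡0⇒n≡0; m^n≡0⇒m≡0; n≮0)
open import Data.Integer using (+_)
open import Data.Rational using (ℚ; _/_)
open import Data.Vec using (Vec; []; _∷_; map; sum; replicate; zipWith; foldr′)
open import Data.Vec.Properties using (∷-injectiveˡ)
open import Data.Vec.Relation.Unary.All using (All; _∷_)
open import Relation.Binary.PropositionalEquality using (_≡_; _≢_; refl; subst; cong₂)

0⃗ : ∀ {r} → Vec ℕ r
0⃗ {r} = replicate r 0

infixl 6 _+⃗_
_+⃗_ : ∀ {r} → Vec ℕ r → Vec ℕ r → Vec ℕ r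
_+⃗_ = zipWith _+_

∑⃗ : ∀ {r k} → Vec (Vec ℕ r) k → Vec ℕ r
∑⃗ = foldr′ _+⃗_ 0⃗

IsPartition : ∀ {r} (k : ℕ) → Vec ℕ r → Vec (Vec ℕ r) k → Set
IsPartition k b xs = ∑⃗ xs ≡ b

-- No absolute values are needed: the entries are non-negative.
‖_‖₁ : ∀ {r} → Vec ℕ r → ℕ
‖ x ‖₁ = sum x

-- The square of the ℓ₂ norm; the norm itself need not be rational.
‖_‖₂² : ∀ {r} → Vec ℕ r → ℕ
‖ x ‖₂² = sum (map (_^ 2) x)

‖x‖₂²≡0⇒x≡0⃗ : ∀ {r} (x : Vec ℕ r) → ‖ x ‖₂² ≡ 0 → x ≡ 0⃗
‖x‖₂²≡0⇒x≡0⃗ []       _  = refl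
‖x‖₂²≡0⇒x≡0⃗ (a ∷ x) eq =
  cong₂ _∷_ (m^n≡0⇒m≡0 a 2 (m+n≡0⇒m≡0 (a ^ 2) eq))
            (‖x‖₂²≡0⇒x≡0⃗ x (m+n≡0⇒n≡0 (a ^ 2) eq))

‖x‖₂²-nonZero : ∀ {r} (x : Vec ℕ r) → x ≢ 0⃗ → NonZero ‖ x ‖₂²
‖x‖₂²-nonZero x x≢0 = ≢-nonZero (λ eq → x≢0 (‖x‖₂²≡0⇒x≡0⃗ x eq))

-- Defined for nonzero x only; the value does not depend on the proof.
D : ∀ {r} (x : Vec ℕ r) → .(x ≢ 0⃗) → ℚ
D x x≢0 = _/_ (+ (‖ x ‖₁ ^ 2)) ‖ x ‖₂² {{‖x‖₂²-nonZero x x≢0}}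

positive⇒≢0⃗ : ∀ {r} {b : Vec ℕ r} → 1 ≤ r → All (0 <_) b → b ≢ 0⃗
positive⇒≢0⃗ {suc _} _ (0<a ∷ _) b≡0 = n≮0 (subst (0 <_) (∷-injectiveˡ b≡0) 0<a)

-- The starting value 0 is neutral: gcd a 0 ≡ a.
gcd⃗ : ∀ {r} → Vec ℕ r → ℕ
gcd⃗ = foldr′ gcd 0

{-# OPTIONS --safe #-}

-- If D(xᵢ) ≥ D(b), expanding 0 ≤ ‖ ‖b‖₁ xᵢ − ‖xᵢ‖₁ b ‖₂² gives
-- ‖b‖₁ ⟨xᵢ, b⟩ ≤ ‖xᵢ‖₁ ‖b‖₂².  Summed over i this is an equality, so every term
-- is one and the expanded square vanishes: ‖b‖₁ xᵢ = ‖xᵢ‖₁ b.  Taking gcds of the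
-- entries, ‖b‖₁ ≤ ‖b‖₁ gcd(xᵢ) = ‖xᵢ‖₁ gcd(b), and summing over i yields k ≤ gcd(b).
-- Conversely D is invariant under scaling, so b may be split into positive
-- multiples of b / gcd(b).
module Submission where

open import Defs
open import Data.Nat
  using (ℕ; zero; suc; _+_; _*_; _∸_; _^_; _≤_; _<_;
         z≤n; s≤s; ∣_-_∣; NonZero; ≢-nonZero)
open import Data.Nat.Divisibility using (_∣_; divides; ∣-trans)
open import Data.Nat.GCD
  using (gcd; gcd[m,n]∣m; gcd[m,n]∣n; c*gcd[m,n]≡gcd[cm,cn];
         gcd[m,n]≡0⇒m≡0; gcd[m,n]≡0⇒n≡0)
open import Data.Nat.Properties
open import Data.Nat.Solver using (module +-*-Solver)
open +-*-Solver using (solve; _:+_; _:*_; _:^_; _:=_; con)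
import Data.Integer as ℤ
import Data.Integer.Properties as ℤ
open import Data.Rational using (_/_; toℚᵘ) renaming (_≥_ to _≥ℚ_; _≤_ to _≤ℚ_)
open import Data.Rational.Properties using (toℚᵘ-fromℚᵘ; toℚᵘ-mono-≤; toℚᵘ-cancel-≤)
open import Data.Rational.Unnormalised using (mkℚᵘ; *≤*)
import Data.Rational.Unnormalised.Properties as ℚᵘ
open import Data.Fin using (Fin)
open import Data.Vec using (Vec; []; _∷_; lookup; map; sum; zipWith)
open import Data.Vec.Properties using (∷-injectiveˡ; ∷-injectiveʳ; lookup-map)
open import Data.Vec.Relation.Unary.All as All using (All; []; _∷_)
open import Data.Vec.Relation.Unary.All.Properties using (lookup⁺; lookup⁻)
open import Data.Product using (Σ-syntax; ∃-syntax; _×_; _,_)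
open import Data.Sum using (inj₁; inj₂)
open import Function.Base using (_∘_)
open import Function.Bundles using (_⇔_; mk⇔; Equivalence)
open import Relation.Binary.PropositionalEquality
  using (_≡_; _≢_; refl; sym; trans; cong; cong₂; subst; module ≡-Reasoning)

private
  variable
    r k : ℕ

-- Comparing fractions by cross-multiplication.

/-≤-/⇔*-≤-* : ∀ a b m n .{{_ : NonZero m}} .{{_ : NonZero n}} →
              (ℤ.+ a / m ≤ℚ ℤ.+ b / n) ⇔ (a * n ≤ b * m)
/-≤-/⇔*-≤-* a b m@(suc m-1) n@(suc n-1) = mk⇔ to from
  where
  -- `_/_` reduces to lowest terms, which hides `a`, `b`, `m` and `n`. The unnormalised fractions
  -- keep them and are equivalent to the reduced ones.
  p≃ = toℚᵘ-fromℚᵘ (mkℚᵘ (ℤ.+ a) m-1)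
  q≃ = toℚᵘ-fromℚᵘ (mkℚᵘ (ℤ.+ b) n-1)

  to : ℤ.+ a / m ≤ℚ ℤ.+ b / n → a * n ≤ b * m
  to p≤q with ℚᵘ.≤-respʳ-≃ q≃ (ℚᵘ.≤-respˡ-≃ p≃ (toℚᵘ-mono-≤ p≤q))
  ... | *≤* an≤bm rewrite sym (ℤ.pos-* a n) | sym (ℤ.pos-* b m) = ℤ.drop‿+≤+ an≤bm

  from : a * n ≤ b * m → ℤ.+ a / m ≤ℚ ℤ.+ b / n
  from an≤bm = toℚᵘ-cancel-≤
    (ℚᵘ.≤-respʳ-≃ (ℚᵘ.≃-sym q≃) (ℚᵘ.≤-respˡ-≃ (ℚᵘ.≃-sym p≃) (*≤* an≤bm′)))
    where
    an≤bm′ : ℤ.+ a ℤ.* ℤ.+ n ℤ.≤ ℤ.+ b ℤ.* ℤ.+ m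
    an≤bm′ rewrite sym (ℤ.pos-* a n) | sym (ℤ.pos-* b m) = ℤ.+≤+ an≤bm

D≥D⇔ : (b x : Vec ℕ r) (b≢0 : b ≢ 0⃗) (x≢0 : x ≢ 0⃗) →
       (D x x≢0 ≥ℚ D b b≢0) ⇔ (‖ b ‖₁ ^ 2 * ‖ x ‖₂² ≤ ‖ x ‖₁ ^ 2 * ‖ b ‖₂²)
D≥D⇔ b x b≢0 x≢0 = /-≤-/⇔*-≤-* (‖ b ‖₁ ^ 2) (‖ x ‖₁ ^ 2) ‖ b ‖₂² ‖ x ‖₂²
  {{‖x‖₂²-nonZero b b≢0}} {{‖x‖₂²-nonZero x x≢0}}

-- Scaling, inner products, norms and gcds of vectors.

infixl 7 _*⃗_ _·_
_*⃗_ : ℕ → Vec ℕ r → Vec ℕ r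
n *⃗ x = map (n *_) x

_·_ : Vec ℕ r → Vec ℕ r → ℕ
x · y = sum (zipWith _*_ x y)

·-self : (x : Vec ℕ r) → x · x ≡ ‖ x ‖₂²
·-self []      = refl
·-self (a ∷ x) = cong₂ _+_ (cong (a *_) (sym (*-identityʳ a))) (·-self x)

‖0⃗‖₁ : ∀ r → ‖ 0⃗ {r} ‖₁ ≡ 0
‖0⃗‖₁ zero    = refl
‖0⃗‖₁ (suc r) = ‖0⃗‖₁ r

‖x‖₁≡0⇒x≡0⃗ : (x : Vec ℕ r) → ‖ x ‖₁ ≡ 0 → x ≡ 0⃗
‖x‖₁≡0⇒x≡0⃗ []      _  = refl
‖x‖₁≡0⇒x≡0⃗ (a ∷ x) eq = cong₂ _∷_ (m+n≡0⇒m≡0 a eq) (‖x‖₁≡0⇒x≡0⃗ x (m+n≡0⇒n≡0 a eq))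

‖+⃗‖₁ : (x y : Vec ℕ r) → ‖ x +⃗ y ‖₁ ≡ ‖ x ‖₁ + ‖ y ‖₁
‖+⃗‖₁ []      []      = refl
‖+⃗‖₁ (a ∷ x) (b ∷ y) = trans (cong (a + b +_) (‖+⃗‖₁ x y))
  (solve 4 (λ a b s t → a :+ b :+ (s :+ t) := a :+ s :+ (b :+ t)) refl a b ‖ x ‖₁ ‖ y ‖₁)

‖∑⃗‖₁ : (xs : Vec (Vec ℕ r) k) → ‖ ∑⃗ xs ‖₁ ≡ sum (map ‖_‖₁ xs)
‖∑⃗‖₁ {r} []   = ‖0⃗‖₁ r
‖∑⃗‖₁ (x ∷ xs) = trans (‖+⃗‖₁ x (∑⃗ xs)) (cong (_ +_) (‖∑⃗‖₁ xs))

·-zeroˡ : (y : Vec ℕ r) → 0⃗ · y ≡ 0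
·-zeroˡ []      = refl
·-zeroˡ (_ ∷ y) = ·-zeroˡ y

·-distribʳ-+⃗ : (z x y : Vec ℕ r) → (x +⃗ y) · z ≡ x · z + y · z
·-distribʳ-+⃗ []      []      []      = refl
·-distribʳ-+⃗ (c ∷ z) (a ∷ x) (b ∷ y) = trans (cong ((a + b) * c +_) (·-distribʳ-+⃗ z x y))
  (solve 5 (λ a b c s t → (a :+ b) :* c :+ (s :+ t) := a :* c :+ s :+ (b :* c :+ t)) refl
         a b c (x · z) (y · z))

∑⃗-· : (y : Vec ℕ r) (xs : Vec (Vec ℕ r) k) → ∑⃗ xs · y ≡ sum (map (_· y) xs)
∑⃗-· y []       = ·-zeroˡ y
∑⃗-· y (x ∷ xs) = trans (·-distribʳ-+⃗ y x (∑⃗ xs)) (cong (_ +_) (∑⃗-· y xs))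

‖*⃗‖₁ : ∀ n (x : Vec ℕ r) → ‖ n *⃗ x ‖₁ ≡ n * ‖ x ‖₁
‖*⃗‖₁ n []      = sym (*-zeroʳ n)
‖*⃗‖₁ n (a ∷ x) = trans (cong (n * a +_) (‖*⃗‖₁ n x)) (sym (*-distribˡ-+ n a ‖ x ‖₁))

‖*⃗‖₂² : ∀ n (x : Vec ℕ r) → ‖ n *⃗ x ‖₂² ≡ n ^ 2 * ‖ x ‖₂²
‖*⃗‖₂² n []      = sym (*-zeroʳ (n ^ 2))
‖*⃗‖₂² n (a ∷ x) = trans (cong ((n * a) ^ 2 +_) (‖*⃗‖₂² n x))
  (solve 3 (λ n a s → (n :* a) :^ 2 :+ n :^ 2 :* s := n :^ 2 :* (a :^ 2 :+ s)) refl n a ‖ x ‖₂²)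

gcd⃗-*⃗ : ∀ n (x : Vec ℕ r) → gcd⃗ (n *⃗ x) ≡ n * gcd⃗ x
gcd⃗-*⃗ n []      = sym (*-zeroʳ n)
gcd⃗-*⃗ n (a ∷ x) = trans (cong (gcd (n * a)) (gcd⃗-*⃗ n x)) (sym (c*gcd[m,n]≡gcd[cm,cn] n a (gcd⃗ x)))

gcd⃗≡0⇒x≡0⃗ : (x : Vec ℕ r) → gcd⃗ x ≡ 0 → x ≡ 0⃗
gcd⃗≡0⇒x≡0⃗ []      _  = refl
gcd⃗≡0⇒x≡0⃗ (a ∷ x) eq =
  cong₂ _∷_ (gcd[m,n]≡0⇒m≡0 eq) (gcd⃗≡0⇒x≡0⃗ x (gcd[m,n]≡0⇒n≡0 a eq))

gcd⃗-∣ : (x : Vec ℕ r) → All (gcd⃗ x ∣_) x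
gcd⃗-∣ []      = []
gcd⃗-∣ (a ∷ x) = gcd[m,n]∣m a (gcd⃗ x) ∷ All.map (∣-trans (gcd[m,n]∣n a (gcd⃗ x))) (gcd⃗-∣ x)

All-∣⇒*⃗ : ∀ {d} {x : Vec ℕ r} → All (d ∣_) x → ∃[ y ] x ≡ d *⃗ y
All-∣⇒*⃗ []                              = [] , refl
All-∣⇒*⃗ {d = d} (divides q a≡q*d ∷ d∣x) with All-∣⇒*⃗ d∣x
... | y , x≡d*y = q ∷ y , cong₂ _∷_ (trans a≡q*d (*-comm q d)) x≡d*y

-- Polarization over the natural numbers.

m²+n²≡2mn+∣m-n∣² : ∀ m n → m ^ 2 + n ^ 2 ≡ 2 * (m * n) + ∣ m - n ∣ ^ 2
m²+n²≡2mn+∣m-n∣² m n with ≤-total m n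
... | inj₁ m≤n rewrite sym (m+[n∸m]≡n m≤n) | ∣m-m+n∣≡n m (n ∸ m) =
    solve 2 (λ m d → m :^ 2 :+ (m :+ d) :^ 2 := con 2 :* (m :* (m :+ d)) :+ d :^ 2) refl m (n ∸ m)
... | inj₂ n≤m rewrite sym (m+[n∸m]≡n n≤m) | ∣-∣-comm (n + (m ∸ n)) n | ∣m-m+n∣≡n n (m ∸ n) =
    solve 2 (λ n d → (n :+ d) :^ 2 :+ n :^ 2 := con 2 :* ((n :+ d) :* n) :+ d :^ 2) refl n (m ∸ n)

-- Stands in for `x` - `y`, which may have negative entries: the signs are lost, but the ℓ₂ norm is
-- the same.
distance : Vec ℕ r → Vec ℕ r → Vec ℕ r
distance = zipWith ∣_-_∣

distance≡0⃗⇒≡ : (x y : Vec ℕ r) → distance x y ≡ 0⃗ → x ≡ y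
distance≡0⃗⇒≡ []      []      _  = refl
distance≡0⃗⇒≡ (a ∷ x) (b ∷ y) eq =
  cong₂ _∷_ (∣m-n∣≡0⇒m≡n (∷-injectiveˡ eq)) (distance≡0⃗⇒≡ x y (∷-injectiveʳ eq))

-- The expansion of ‖x - y‖₂², obtained coordinate by coordinate. The cross term stands on the
-- right, so that no truncated subtraction occurs.
‖‖₂²-polarization : ∀ (x y : Vec ℕ r) →
  ‖ x ‖₂² + ‖ y ‖₂² ≡ 2 * (x · y) + ‖ distance x y ‖₂²
‖‖₂²-polarization []      []      = refl
‖‖₂²-polarization (a ∷ x) (b ∷ y) = begin
  (a ^ 2 + ‖ x ‖₂²) + (b ^ 2 + ‖ y ‖₂²)
    ≡⟨ solve 4 (λ a x b y → (a :+ x) :+ (b :+ y) := (a :+ b) :+ (x :+ y)) refl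
             (a ^ 2) ‖ x ‖₂² (b ^ 2) ‖ y ‖₂² ⟩
  (a ^ 2 + b ^ 2) + (‖ x ‖₂² + ‖ y ‖₂²)
    ≡⟨ cong₂ _+_ (m²+n²≡2mn+∣m-n∣² a b) (‖‖₂²-polarization x y) ⟩
  (2 * (a * b) + ∣ a - b ∣ ^ 2) + (2 * (x · y) + ‖ distance x y ‖₂²)
    ≡⟨ solve 4 (λ p d q e → (con 2 :* p :+ d) :+ (con 2 :* q :+ e)
                          := con 2 :* (p :+ q) :+ (d :+ e)) refl
             (a * b) (∣ a - b ∣ ^ 2) (x · y) ‖ distance x y ‖₂² ⟩
  2 * (a * b + x · y) + (∣ a - b ∣ ^ 2 + ‖ distance x y ‖₂²) ∎
  where
  open ≡-Reasoning

*⃗-·-*⃗ : ∀ m n (x y : Vec ℕ r) → (m *⃗ x) · (n *⃗ y) ≡ n * (m * (x · y))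
*⃗-·-*⃗ m n []      []      = sym (trans (cong (n *_) (*-zeroʳ m)) (*-zeroʳ n))
*⃗-·-*⃗ m n (a ∷ x) (b ∷ y) = trans (cong ((m * a) * (n * b) +_) (*⃗-·-*⃗ m n x y))
  (solve 5 (λ m n a b p → (m :* a) :* (n :* b) :+ n :* (m :* p) := n :* (m :* (a :* b :+ p))) refl
         m n a b (x · y))

-- Comparison of a single part with `b`, and its equality case.

module _ (b x : Vec ℕ r) (D≤D : ‖ b ‖₁ ^ 2 * ‖ x ‖₂² ≤ ‖ x ‖₁ ^ 2 * ‖ b ‖₂²) where

  private
    S = ‖ b ‖₁
    t = ‖ x ‖₁

    gap : ℕ
    gap = ‖ distance (S *⃗ x) (t *⃗ b) ‖₂²

    -- Polarization applied to `S *⃗ x` and `t *⃗ b`, with `D≤D` bounding the first square by the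
    -- second. Dropping `gap` gives the inner product bound; equality in that bound leaves no room
    -- for `gap`.
    expansion-≤ : 2 * (t * (S * (x · b))) + gap ≤ 2 * (t * (t * ‖ b ‖₂²))
    expansion-≤ = begin
      2 * (t * (S * (x · b))) + gap         ≡⟨ cong (λ p → 2 * p + gap) (*⃗-·-*⃗ S t x b) ⟨
      2 * ((S *⃗ x) · (t *⃗ b)) + gap         ≡⟨ ‖‖₂²-polarization (S *⃗ x) (t *⃗ b) ⟨
      ‖ S *⃗ x ‖₂² + ‖ t *⃗ b ‖₂²             ≡⟨ cong₂ _+_ (‖*⃗‖₂² S x) (‖*⃗‖₂² t b) ⟩
      S ^ 2 * ‖ x ‖₂² + t ^ 2 * ‖ b ‖₂²     ≤⟨ +-monoˡ-≤ _ D≤D ⟩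
      t ^ 2 * ‖ b ‖₂² + t ^ 2 * ‖ b ‖₂²     ≡⟨ solve 2 (λ t q → t :^ 2 :* q :+ t :^ 2 :* q
                                                             := con 2 :* (t :* (t :* q))) refl t ‖ b ‖₂² ⟩
      2 * (t * (t * ‖ b ‖₂²))               ∎
      where
      open ≤-Reasoning

  D≤D⇒·-≤ : x ≢ 0⃗ → S * (x · b) ≤ t * ‖ b ‖₂²
  -- The common factor `t` is positive because `x` is nonzero, so it can be cancelled.
  D≤D⇒·-≤ x≢0 = *-cancelˡ-≤ t (*-cancelˡ-≤ 2 (m+n≤o⇒m≤o _ expansion-≤))
    where instance _ = ≢-nonZero (x≢0 ∘ ‖x‖₁≡0⇒x≡0⃗ x)

  ·-≡⇒proportional : S * (x · b) ≡ t * ‖ b ‖₂² → S *⃗ x ≡ t *⃗ b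
  ·-≡⇒proportional eq = distance≡0⃗⇒≡ _ _ (‖x‖₂²≡0⇒x≡0⃗ _ gap≡0)
    where
    gap≡0 : gap ≡ 0
    -- By `eq` the main terms of `expansion-≤` agree; cancelling them leaves `gap` ≤ 0.
    gap≡0 = n≤0⇒n≡0 (+-cancelˡ-≤ _ gap 0 (≤-trans expansion-≤
      (≤-reflexive (trans (cong (λ p → 2 * (t * p)) (sym eq)) (sym (+-identityʳ _))))))

-- Termwise comparison of sums.

module _ {A : Set} {f g : A → ℕ} where

  sum-mono-≤ : {xs : Vec A k} → All (λ x → f x ≤ g x) xs → sum (map f xs) ≤ sum (map g xs)
  sum-mono-≤ []       = z≤n
  sum-mono-≤ (p ∷ ps) = +-mono-≤ p (sum-mono-≤ ps)

  sum-≡⇒All-≡ : {xs : Vec A k} → All (λ x → f x ≤ g x) xs → sum (map f xs) ≡ sum (map g xs) →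
                All (λ x → f x ≡ g x) xs
  sum-≡⇒All-≡ []                     _  = []
  sum-≡⇒All-≡ {xs = x ∷ xs} (p ∷ ps) eq = fx≡gx ∷ sum-≡⇒All-≡ ps (+-cancelˡ-≡ (f x) _ _
    (trans eq (cong (_+ _) (sym fx≡gx))))
    where
    fx≡gx : f x ≡ g x
    -- With tail sums F ≤ G, equality of the totals gives `g x` + G = `f x` + F ≤ `f x` + G; cancel
    -- G.
    fx≡gx = ≤-antisym p (+-cancelʳ-≤ (sum (map g xs)) (g x) (f x)
      (≤-trans (≤-reflexive (sym eq)) (+-monoʳ-≤ (f x) (sum-mono-≤ ps))))

sum-map-*ˡ : ∀ {A : Set} n (f : A → ℕ) (xs : Vec A k) → sum (map (λ x → n * f x) xs) ≡ n * sum (map f xs)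
sum-map-*ˡ n f []       = sym (*-zeroʳ n)
sum-map-*ˡ n f (x ∷ xs) = trans (cong (_ +_) (sum-map-*ˡ n f xs)) (sym (*-distribˡ-+ n (f x) _))

sum-map-const : ∀ {A : Set} n (xs : Vec A k) → sum (map (λ _ → n) xs) ≡ k * n
sum-map-const n []       = refl
sum-map-const n (_ ∷ xs) = cong (n +_) (sum-map-const n xs)

-- Upper bound on the number of parts.

proportional⇒‖b‖₁≤ : (b x : Vec ℕ r) → x ≢ 0⃗ → ‖ b ‖₁ *⃗ x ≡ ‖ x ‖₁ *⃗ b → ‖ b ‖₁ ≤ gcd⃗ b * ‖ x ‖₁
proportional⇒‖b‖₁≤ b x x≢0 eq = begin
  -- `x` is nonzero, so its gcd is at least 1.
  ‖ b ‖₁              ≤⟨ m≤m*n ‖ b ‖₁ (gcd⃗ x) ⟩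
  ‖ b ‖₁ * gcd⃗ x      ≡⟨ gcd⃗-*⃗ ‖ b ‖₁ x ⟨
  gcd⃗ (‖ b ‖₁ *⃗ x)    ≡⟨ cong gcd⃗ eq ⟩
  gcd⃗ (‖ x ‖₁ *⃗ b)    ≡⟨ gcd⃗-*⃗ ‖ x ‖₁ b ⟩
  ‖ x ‖₁ * gcd⃗ b      ≡⟨ *-comm ‖ x ‖₁ (gcd⃗ b) ⟩
  gcd⃗ b * ‖ x ‖₁      ∎
  where
  open ≤-Reasoning
  instance _ = ≢-nonZero (x≢0 ∘ gcd⃗≡0⇒x≡0⃗ x)

partition⇒k≤gcd⃗ : {b : Vec ℕ r} → b ≢ 0⃗ → (xs : Vec (Vec ℕ r) k) → IsPartition k b xs →
  All (_≢ 0⃗) xs → All (λ x → ‖ b ‖₁ ^ 2 * ‖ x ‖₂² ≤ ‖ x ‖₁ ^ 2 * ‖ b ‖₂²) xs → k ≤ gcd⃗ b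
-- Matching `refl` turns `b` into `∑⃗ xs`, so its norm and inner products split over the parts. The
-- bound is proved after multiplying by `S`, which is positive since `b` is nonzero.
partition⇒k≤gcd⃗ {k = k} {b} b≢0 xs refl xs≢0 D≤Ds = *-cancelʳ-≤ k (gcd⃗ b) S (begin
  k * S                              ≡⟨ sum-map-const S xs ⟨
  sum (map (λ _ → S) xs)             ≤⟨ sum-mono-≤ (All.map S≤ (All.zip (xs≢0 , proportional))) ⟩
  sum (map (λ x → gcd⃗ b * ‖ x ‖₁) xs)  ≡⟨ sum-map-*ˡ (gcd⃗ b) ‖_‖₁ xs ⟩
  gcd⃗ b * sum (map ‖_‖₁ xs)          ≡⟨ cong (gcd⃗ b *_) (‖∑⃗‖₁ xs) ⟨
  gcd⃗ b * S                          ∎)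
  where
  open ≤-Reasoning
  S = ‖ b ‖₁
  Q = ‖ b ‖₂²
  instance _ = ≢-nonZero (b≢0 ∘ ‖x‖₁≡0⇒x≡0⃗ b)

  S≤ : ∀ {x} → x ≢ 0⃗ × S *⃗ x ≡ ‖ x ‖₁ *⃗ b → S ≤ gcd⃗ b * ‖ x ‖₁
  S≤ {x} (x≢0 , eq) = proportional⇒‖b‖₁≤ b x x≢0 eq

  -- Both the inner product with `b` and the ℓ₁ norm are additive over the parts, so each side
  -- collapses to the product of `S` and `Q`.
  sums-≡ : sum (map (λ x → S * (x · b)) xs) ≡ sum (map (λ x → Q * ‖ x ‖₁) xs)
  sums-≡ = begin-equality
    sum (map (λ x → S * (x · b)) xs)   ≡⟨ sum-map-*ˡ S (_· b) xs ⟩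
    S * sum (map (_· b) xs)            ≡⟨ cong (S *_) (∑⃗-· b xs) ⟨
    S * (b · b)                        ≡⟨ cong (S *_) (·-self b) ⟩
    S * Q                              ≡⟨ *-comm S Q ⟩
    Q * S                              ≡⟨ cong (Q *_) (‖∑⃗‖₁ xs) ⟩
    Q * sum (map ‖_‖₁ xs)              ≡⟨ sum-map-*ˡ Q ‖_‖₁ xs ⟨
    sum (map (λ x → Q * ‖ x ‖₁) xs)    ∎

  ·-≤ : All (λ x → S * (x · b) ≤ Q * ‖ x ‖₁) xs
  ·-≤ = All.map (λ {x} (x≢0 , D≤D) → ≤-trans (D≤D⇒·-≤ b x D≤D x≢0) (≤-reflexive (*-comm ‖ x ‖₁ Q)))
                (All.zip (xs≢0 , D≤Ds))

  -- The termwise inequalities `·-≤` have equal totals, so each of them is an equality, and the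
  -- equality case applies to every part.
  proportional : All (λ x → S *⃗ x ≡ ‖ x ‖₁ *⃗ b) xs
  proportional = All.map (λ {x} (D≤D , eq) → ·-≡⇒proportional b x D≤D (trans eq (*-comm Q ‖ x ‖₁)))
                         (All.zip (D≤Ds , sum-≡⇒All-≡ ·-≤ sums-≡))

-- Splitting into positive multiples of one vector.

*⃗-distribʳ-+ : ∀ m n (c : Vec ℕ r) → (m + n) *⃗ c ≡ m *⃗ c +⃗ n *⃗ c
*⃗-distribʳ-+ m n []      = refl
*⃗-distribʳ-+ m n (a ∷ c) = cong₂ _∷_ (*-distribʳ-+ a m n) (*⃗-distribʳ-+ m n c)

0*⃗ : (c : Vec ℕ r) → 0 *⃗ c ≡ 0⃗
0*⃗ []      = refl
0*⃗ (_ ∷ c) = cong (0 ∷_) (0*⃗ c)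

∑⃗-multiples : (c : Vec ℕ r) (ms : Vec ℕ k) → ∑⃗ (map (_*⃗ c) ms) ≡ sum ms *⃗ c
∑⃗-multiples c []       = sym (0*⃗ c)
∑⃗-multiples c (m ∷ ms) = trans (cong (m *⃗ c +⃗_) (∑⃗-multiples c ms)) (sym (*⃗-distribʳ-+ m (sum ms) c))

-- The ℓ₁ norm detects zero vectors and is multiplicative under scaling, which reduces the claim to
-- a product in ℕ.
*⃗-≢0⃗ : ∀ {m} {c : Vec ℕ r} → 0 < m → c ≢ 0⃗ → m *⃗ c ≢ 0⃗
*⃗-≢0⃗ {r} {m} {c} 0<m c≢0 mc≡0 with m*n≡0⇒m≡0∨n≡0 m (trans (sym (‖*⃗‖₁ m c)) (trans (cong ‖_‖₁ mc≡0) (‖0⃗‖₁ r)))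
... | inj₁ m≡0 = <⇒≢ 0<m (sym m≡0)
... | inj₂ c≡0 = c≢0 (‖x‖₁≡0⇒x≡0⃗ c c≡0)

-- Scale invariance of the diversity, with denominators cleared: both sides equal m²n²‖c‖₁²‖c‖₂².
multiples-≤ : ∀ m n (c : Vec ℕ r) →
  ‖ m *⃗ c ‖₁ ^ 2 * ‖ n *⃗ c ‖₂² ≤ ‖ n *⃗ c ‖₁ ^ 2 * ‖ m *⃗ c ‖₂²
multiples-≤ m n c rewrite ‖*⃗‖₁ m c | ‖*⃗‖₁ n c | ‖*⃗‖₂² m c | ‖*⃗‖₂² n c = ≤-reflexive
  (solve 4 (λ m n s q → (m :* s) :^ 2 :* (n :^ 2 :* q) := (n :* s) :^ 2 :* (m :^ 2 :* q)) refl
         m n ‖ c ‖₁ ‖ c ‖₂²)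

-- Every part is 1 except the last, which takes the remainder n - (k - 1); it is positive because k
-- ≤ n.
positive-composition : ∀ {k n} → 1 ≤ k → k ≤ n → Σ[ ms ∈ Vec ℕ k ] (sum ms ≡ n × All (0 <_) ms)
positive-composition {suc zero}    {n}     _ 1≤n       = n ∷ [] , +-identityʳ n , 1≤n ∷ []
positive-composition {suc (suc k)} {suc n} _ (s≤s k<n) with positive-composition (s≤s z≤n) k<n
... | ms , eq , ms>0 = 1 ∷ ms , cong suc eq , s≤s z≤n ∷ ms>0

theorem1 : ∀ (r k : ℕ) (1≤r : 1 ≤ r) (1≤k : 1 ≤ k)
    (b : Vec ℕ r) (b>0 : All (0 <_) b) →
    (Σ[ xs ∈ Vec (Vec ℕ r) k ]
    (IsPartition k b xs ×
    (Σ[ xs≢0 ∈ (∀ (i : Fin k) → lookup xs i ≢ 0⃗) ]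
    (∀ (i : Fin k) →
    D (lookup xs i) (xs≢0 i) ≥ℚ D b (positive⇒≢0⃗ 1≤r b>0)))))
    ⇔ (k ≤ gcd⃗ b)
theorem1 r k 1≤r 1≤k b b>0 = mk⇔
  (λ (xs , partition , xs≢0 , D≥D) → partition⇒k≤gcd⃗ b≢0 xs partition (lookup⁻ xs≢0)
     (lookup⁻ λ i → Equivalence.to (D≥D⇔ b (lookup xs i) b≢0 (xs≢0 i)) (D≥D i)))
  construct
  where
  b≢0 : b ≢ 0⃗
  b≢0 = positive⇒≢0⃗ 1≤r b>0

  construct : k ≤ gcd⃗ b → _
  -- `c` is `b` divided by its gcd, and `ms` splits that gcd into `k` positive parts, so the vectors
  -- `m *⃗ c` add up to `b`.
  construct k≤g with All-∣⇒*⃗ (gcd⃗-∣ b) | positive-composition 1≤k k≤g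
  ... | c , b≡g*c | ms , sum≡g , ms>0 =
    xs , trans (∑⃗-multiples c ms) (trans (cong (_*⃗ c) sum≡g) (sym b≡g*c)) , xs≢0 ,
    λ i → Equivalence.from (D≥D⇔ b (lookup xs i) b≢0 (xs≢0 i)) (D≤D i)
    where
    xs : Vec (Vec ℕ r) k
    xs = map (_*⃗ c) ms

    c≢0 : c ≢ 0⃗
    c≢0 c≡0 = b≢0 (‖x‖₁≡0⇒x≡0⃗ b (trans (cong ‖_‖₁ b≡g*c) (trans (‖*⃗‖₁ (gcd⃗ b) c)
      (trans (cong (λ v → gcd⃗ b * ‖ v ‖₁) c≡0) (trans (cong (gcd⃗ b *_) (‖0⃗‖₁ r)) (*-zeroʳ (gcd⃗ b)))))))

    xs≢0 : ∀ i → lookup xs i ≢ 0⃗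
    xs≢0 i rewrite lookup-map i (_*⃗ c) ms = *⃗-≢0⃗ (lookup⁺ ms>0 i) c≢0

    D≤D : ∀ i → ‖ b ‖₁ ^ 2 * ‖ lookup xs i ‖₂² ≤ ‖ lookup xs i ‖₁ ^ 2 * ‖ b ‖₂²
    D≤D i rewrite lookup-map i (_*⃗ c) ms =
      -- `b` also occurs inside `gcd⃗ b`, so the motive marks exactly the occurrences to be
      -- exchanged for `gcd⃗ b *⃗ c`.
      subst (λ v → ‖ v ‖₁ ^ 2 * ‖ m *⃗ c ‖₂² ≤ ‖ m *⃗ c ‖₁ ^ 2 * ‖ v ‖₂²) (sym b≡g*c)
            (multiples-≤ (gcd⃗ b) m c)
      where m = lookup ms i
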